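{- Let $\mathcal Q(x,y;a,b,c)$ be the equality gadget with terminals $x,y$ and auxiliary variables $a,b,c$. An assignment of bits to the terminals $x,y$ extends to a proper two-colouring of the gadget if and only if $x=y$. Moreover, fix a random proper two-colouring $(x,y,a,b,c)$ of the gadget (a probability distribution supported on proper two-colourings) for which the common terminal bit $T:=x=y$ is uniform on $\{0,1\}$. Then all six gadget edges are uniformly distributed on $\mathrm{NAE}_3$ if and only if, for each $t\in\{0,1\}$, conditional on $T=t$, exactly one of $a,b,c$, chosen uniformly at random, equals $t$ and the other two equal $1-t$. In particular, the probability-preserving conditional extension kernel is unique.
   Context: $\mathrm{NAE}_3=\{0,1\}^3\setminus\{000,111\}$. The gadget $\mathcal Q(x,y;a,b,c)$ consists of the six ordered hyperedges $(x,a,b),(x,a,c),(x,b,c),(y,a,b),(y,a,c),(y,b,c)$ on five distinct vertices. A proper two-colouring is an assignment of bits in $\{0,1\}$ to $x,y,a,b,c$ that is nonconstant on each of the six hyperedges. A gadget edge $(p,q,s)$ is uniformly distributed on $\mathrm{NAE}_3$ if the random triple of bits assigned to $(p,q,s)$ takes each of the six values in $\mathrm{NAE}_3$ with probability $1/6$. The conditional extension kernel is the conditional distribution of $(a,b,c)$ given $T$; it is called probability-preserving if it makes all six gadget edges uniform on $\mathrm{NAE}_3$ when $T$ is uniform. -}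

module Defs where

open import Algebra.Apartness.Bundles using (HeytingCommutativeRing; HeytingField)
import Algebra.Apartness.Properties.HeytingCommutativeRing as HeytingProperties
import Algebra.Definitions.RawMonoid as RawMonoidDefs
import Algebra.Properties.Ring as RingProperties
open import Algebra.Bundles using (CommutativeRing)
open import Data.Bool.Base using (Bool; true; false; not; if_then_else_)
import Data.Bool.Properties as Bool
open import Data.Fin.Base using (Fin; zero; suc)
open import Data.List.Base as List using (List)
open import Data.List.Membership.Propositional using (_∈_)
open import Data.List.Relation.Unary.All using (All)
open import Data.Nat.Base as ℕ using (ℕ; NonZero)
open import Data.Product.Base using (∃; _×_; _,_; proj₁; proj₂)
import Data.Rational.Base as ℚ
import Data.Rational.Properties as ℚ
open import Data.Sum.Base using (_⊎_; inj₁; inj₂)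
open import Data.Vec.Base using (Vec; []; _∷_; lookup; map; replicate; _[_]≔_)
open import Data.Vec.Properties using (≡-dec)
open import Level using (Level; _⊔_; 0ℓ) renaming (suc to lsuc)
open import Relation.Binary.Core using (Rel)
open import Relation.Binary.Definitions using (tri<; tri≈; tri>)
open import Relation.Binary.PropositionalEquality using (_≡_; _≢_)
open import Relation.Binary.Structures using (IsStrictPartialOrder)
open import Relation.Nullary.Decidable using (does; _×-dec_)
open import Relation.Nullary.Negation using (¬_; contradiction)
open import Relation.Unary using (Pred; Decidable)

-- Probabilities take values in an arbitrary ordered field.  Apartness means
-- "strictly less or strictly greater", so that (classically) this is the
-- usual notion of totally ordered field, which includes ℝ; constructively it
-- does not require the order or the equality to be decidable.
record OrderedField (c ℓ₁ ℓ₂ ℓ₃ : Level) : Set (lsuc (c ⊔ ℓ₁ ⊔ ℓ₂ ⊔ ℓ₃)) where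
  field
    heytingField : HeytingField c ℓ₁ ℓ₂

  open HeytingField heytingField public

  infix 4 _<_
  field
    _<_                  : Rel Carrier ℓ₃
    isStrictPartialOrder : IsStrictPartialOrder _≈_ _<_
    <⇒#                  : ∀ {x y} → x < y → x # y
    #⇒<⊎>                : ∀ {x y} → x # y → x < y ⊎ y < x
    +-monoˡ-<            : ∀ z {x y} → x < y → x + z < y + z
    *-pos                : ∀ {x y} → 0# < x → 0# < y → 0# < x * y

  open IsStrictPartialOrder isStrictPartialOrder public
    using (<-respˡ-≈; <-respʳ-≈)
    renaming (irrefl to <-irrefl; trans to <-trans)

  open HeytingCommutativeRing heytingCommutativeRing public using (commutativeRing)
  open CommutativeRing commutativeRing public using (ring; +-rawMonoid)
  open HeytingProperties heytingCommutativeRing public using (1#0; x-0≈x; #-congʳ)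
  open RawMonoidDefs +-rawMonoid
    using () renaming (_×_ to _·_)

  private module R = RingProperties ring

  fromℕ : ℕ → Carrier
  fromℕ n = n · 1#

  0<1 : 0# < 1#
  0<1 with #⇒<⊎> 1#0
  ... | inj₂ 0<1 = 0<1
  ... | inj₁ 1<0 = <-respʳ-≈ -1*-1≈1 (*-pos 0<-1 0<-1)
    where
    0<-1 : 0# < - 1#
    0<-1 = <-respʳ-≈ (+-identityˡ (- 1#)) (<-respˡ-≈ (-‿inverseʳ 1#) (+-monoˡ-< (- 1#) 1<0))
    -1*-1≈1 : - 1# * - 1# ≈ 1#
    -1*-1≈1 = trans (R.-1*x≈-x (- 1#)) (R.-‿involutive 1#)

  fromℕ-pos : ∀ n → 0# < fromℕ (ℕ.suc n)
  fromℕ-pos ℕ.zero    = <-respʳ-≈ (sym (+-identityʳ 1#)) 0<1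
  fromℕ-pos (ℕ.suc n) = <-trans (fromℕ-pos n)
    (<-respˡ-≈ (+-identityˡ _) (+-monoˡ-< (fromℕ (ℕ.suc n)) 0<1))

  inv : ∀ x → x # 0# → Carrier
  inv x x#0 = proj₁ (#⇒invertible x#0)

  fromℕ#0 : ∀ n .{{_ : NonZero n}} → fromℕ n # 0#
  fromℕ#0 (ℕ.suc n) = #-sym (<⇒# (fromℕ-pos n))

  1/_ : ∀ n .{{_ : NonZero n}} → Carrier
  1/ n = inv (fromℕ n) (fromℕ#0 n)

  1/#0 : ∀ n .{{_ : NonZero n}} → (1/ n) # 0#
  1/#0 n = invertible⇒#
    ( fromℕ n
    , trans (*-congˡ (x-0≈x _)) (trans (*-congʳ (sym (x-0≈x _))) (proj₂ (proj₂ i)))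
    , trans (*-congʳ (x-0≈x _)) (trans (*-congˡ (sym (x-0≈x _))) (proj₁ (proj₂ i))))
    where i = #⇒invertible (fromℕ#0 n)

ℚ-orderedField : OrderedField 0ℓ 0ℓ 0ℓ 0ℓ
ℚ-orderedField = record
  { heytingField         = ℚ.heytingField
  ; _<_                  = ℚ._<_
  ; isStrictPartialOrder = ℚ.<-isStrictPartialOrder
  ; <⇒#                  = ℚ.<⇒≢
  ; #⇒<⊎>                = λ {x} {y} x≢y → connex x y x≢y
  ; +-monoˡ-<            = ℚ.+-monoˡ-<
  ; *-pos                = λ {x} {y} 0<x 0<y → ℚ.positive⁻¹ (x ℚ.* y)
      {{ℚ.pos*pos⇒pos x {{ℚ.positive 0<x}} y {{ℚ.positive 0<y}}}}
  }
  where
  connex : ∀ x y → x ≢ y → x ℚ.< y ⊎ y ℚ.< x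
  connex x y x≢y with ℚ.<-cmp x y
  ... | tri< x<y _ _ = inj₁ x<y
  ... | tri≈ _ x≡y _ = contradiction x≡y x≢y
  ... | tri> _ _ y<x = inj₂ y<x

-- The bits 0 and 1 are false and true.
Triple : Set
Triple = Vec Bool 3

NAE₃ : Pred Triple 0ℓ
NAE₃ v = v ≢ replicate 3 false × v ≢ replicate 3 true

𝒬 : ∀ {v} {V : Set v} (x y a b c : V) → List (Vec V 3)
𝒬 x y a b c =
    (x ∷ a ∷ b ∷ []) List.∷ (x ∷ a ∷ c ∷ []) List.∷ (x ∷ b ∷ c ∷ [])
  List.∷ (y ∷ a ∷ b ∷ []) List.∷ (y ∷ a ∷ c ∷ []) List.∷ (y ∷ b ∷ c ∷ [])
  List.∷ List.[]

Vertex : Set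
Vertex = Fin 5

x y a b c : Vertex
x = zero
y = suc zero
a = suc (suc zero)
b = suc (suc (suc zero))
c = suc (suc (suc (suc zero)))

gadget : List (Vec Vertex 3)
gadget = 𝒬 x y a b c

Assignment : Set
Assignment = Vec Bool 5

bits : ∀ {k} → Assignment → Vec Vertex k → Vec Bool k
bits σ = map (lookup σ)

Proper : Pred Assignment 0ℓ
Proper σ = All (λ e → NAE₃ (bits σ e)) gadget

terminals : Vec Vertex 2
terminals = x ∷ y ∷ []

auxiliaries : Vec Vertex 3
auxiliaries = a ∷ b ∷ c ∷ []

-- The bits of a, b, c when the i-th of them equals t and the other two
-- equal 1 - t.
oneEqual : Bool → Fin 3 → Triple
oneEqual t i = replicate 3 (not t) [ i ]≔ t

module Random {p ℓ₁ ℓ₂ ℓ₃} (K : OrderedField p ℓ₁ ℓ₂ ℓ₃) where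

  open OrderedField K

  ∑ : ∀ n → (Vec Bool n → Carrier) → Carrier
  ∑ ℕ.zero    f = f []
  ∑ (ℕ.suc n) f = ∑ n (λ v → f (false ∷ v)) + ∑ n (λ v → f (true ∷ v))

  record RandomProperColouring : Set (p ⊔ ℓ₁ ⊔ ℓ₃) where
    field
      weight    : Assignment → Carrier
      nonneg    : ∀ σ → ¬ (weight σ < 0#)
      total     : ∑ 5 weight ≈ 1#
      supported : ∀ σ → ¬ Proper σ → weight σ ≈ 0#

  open RandomProperColouring public

  module _ (μ : RandomProperColouring) where

    Pr : ∀ {q} {A : Pred Assignment q} → Decidable A → Carrier
    Pr A? = ∑ 5 (λ σ → if does (A? σ) then weight μ σ else 0#)

    Pr[_∣_,_] : ∀ {q r} {A : Pred Assignment q} {B : Pred Assignment r} →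
                Decidable A → (B? : Decidable B) → Pr B? # 0# → Carrier
    Pr[ A? ∣ B? , pos ] = Pr (λ σ → A? σ ×-dec B? σ) * inv (Pr B?) pos

    bits≟ : ∀ {k} (vs : Vec Vertex k) (v : Vec Bool k) →
            Decidable (λ σ → bits σ vs ≡ v)
    bits≟ vs v σ = ≡-dec Bool._≟_ (bits σ vs) v

    -- The event T = t, where T is the common bit of the two terminals.
    T≟ : (t : Bool) → Decidable (λ σ → bits σ terminals ≡ replicate 2 t)
    T≟ t = bits≟ terminals (replicate 2 t)

    TerminalUniform : Set ℓ₁
    TerminalUniform = ∀ t → Pr (T≟ t) ≈ 1/ 2

    UniformOnNAE₃ : Vec Vertex 3 → Set ℓ₁
    UniformOnNAE₃ e = ∀ v → NAE₃ v → Pr (bits≟ e v) ≈ 1/ 6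

    AllEdgesUniform : Set ℓ₁
    AllEdgesUniform = ∀ e → e ∈ gadget → UniformOnNAE₃ e

  Kernel : Set p
  Kernel = Bool → Triple → Carrier

  infix 4 _≋_
  _≋_ : Rel Kernel ℓ₁
  κ ≋ κ′ = ∀ t v → κ t v ≈ κ′ t v

  module _ (μ : RandomProperColouring) (T-uniform : TerminalUniform μ) where

    -- The conditional distribution of (a , b , c) given T.
    conditional : Kernel
    conditional t v = Pr[_∣_,_] μ (bits≟ μ auxiliaries v) (T≟ μ t)
      (#-congʳ (sym (T-uniform t)) (1/#0 2))

    -- Conditional on T = t, the bits of (a , b , c) are oneEqual t i with i
    -- uniform on Fin 3.
    ExactlyOneEqualUniformly : Bool → Set ℓ₁
    ExactlyOneEqualUniformly t =
      (∀ i → conditional t (oneEqual t i) ≈ 1/ 3) ×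
      (∀ v → (∀ i → v ≢ oneEqual t i) → conditional t v ≈ 0#)

  IsConditionalOf : Kernel → (μ : RandomProperColouring) → TerminalUniform μ → Set ℓ₁
  IsConditionalOf κ μ T-uniform = κ ≋ conditional μ T-uniform

  -- Every family of laws of (a , b , c) on proper extensions of x = y = t
  -- arises this way: draw T uniformly, then (a , b , c) from the T-th law.
  IsExtensionKernel : Kernel → Set (p ⊔ ℓ₁ ⊔ ℓ₃)
  IsExtensionKernel κ = ∃ λ μ → ∃ λ u → IsConditionalOf κ μ u

  ProbabilityPreserving : Kernel → Set (p ⊔ ℓ₁ ⊔ ℓ₃)
  ProbabilityPreserving κ =
    IsExtensionKernel κ × (∀ μ u → IsConditionalOf κ μ u → AllEdgesUniform μ)

{-# OPTIONS --safe #-}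

-- For each terminal bit t there are four proper colourings: those in which at
-- most one of a, b, c equals t.  The edges (x , a , b) and (x , a , c) see each
-- of the three in which exactly one equals t as the only colouring with its
-- value there, so uniform edges force these three weights to be 1/6.  The value
-- (t , 1 - t , 1 - t) of (x , a , b) is shared by one of them and the colouring
-- in which none equals t, whose weight is therefore 0.  Conversely, these
-- weights put exactly one colouring of weight 1/6 above each value of each edge.
-- Since T is uniform, conditional probabilities are the weights divided by 1/2.
module Submission where

open import Defs
open import Algebra.Bundles using (CommutativeRing)
import Algebra.Properties.Ring as RingProperties
import Algebra.Properties.Semiring.Mult as SemiringMult
open import Data.Bool.Base using (Bool; true; false; not; if_then_else_)
import Data.Bool.Properties as Bool
open import Data.Empty using (⊥-elim)
open import Data.Fin.Base using (zero; suc)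
import Data.Fin.Properties as Fin
open import Data.List.Base as List using (List; filter; foldr; length; _++_)
import Data.List.Properties as List
open import Data.List.Membership.Propositional using (_∈_)
open import Data.List.Membership.Propositional.Properties using (∈-++⁺ˡ; ∈-++⁺ʳ; ∈-map⁺)
open import Data.List.Relation.Unary.All as All using (All)
open import Data.List.Relation.Unary.All.Properties using (all-filter)
open import Data.List.Relation.Unary.Any using (here; there)
open import Data.Nat.Base as ℕ using (ℕ; NonZero)
import Data.Nat.Properties as ℕ
open import Data.Product using (∃; ∃!; _×_; _,_; proj₁; proj₂)
open import Data.Vec.Base using (Vec; []; _∷_; head; lookup; replicate; tail)
open import Data.Vec.Properties using (≡-dec)
open import Function.Base using (_∘_)
open import Function.Bundles using (_⇔_; mk⇔; module Equivalence)
import Relation.Binary.Reasoning.Setoid as SetoidReasoning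
open import Relation.Binary.PropositionalEquality as ≡ using (_≡_)
open import Relation.Nullary.Decidable
  using (Dec; yes; no; does; map′; toWitness; _×-dec_; _→-dec_; ¬?)
open import Relation.Nullary.Negation using (¬_)
open import Relation.Unary using (Pred; Decidable)

-- Exhaustive checks over bit vectors.

assignments : ∀ n → List (Vec Bool n)
assignments ℕ.zero    = List.[ [] ]
assignments (ℕ.suc n) =
  List.map (false ∷_) (assignments n) ++ List.map (true ∷_) (assignments n)

∈-assignments : ∀ {n} (v : Vec Bool n) → v ∈ assignments n
∈-assignments []          = here ≡.refl
∈-assignments (false ∷ v) = ∈-++⁺ˡ (∈-map⁺ (false ∷_) (∈-assignments v))
∈-assignments (true ∷ v)  = ∈-++⁺ʳ _ (∈-map⁺ (true ∷_) (∈-assignments v))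

-- Through `toWitness`, finite facts about colourings are proved by evaluating this decision.
∀-bits? : ∀ {n p} {P : Pred (Vec Bool n) p} → Decidable P → Dec (∀ v → P v)
∀-bits? P? = map′ (λ ps v → All.lookup ps (∈-assignments v)) (λ p → All.universal p _)
  (All.all? P? (assignments _))

-- Proper colourings of the gadget.

nae? : Decidable NAE₃
nae? v = ¬? (≡-dec Bool._≟_ v _) ×-dec ¬? (≡-dec Bool._≟_ v _)

proper? : Decidable Proper
proper? σ = All.all? (λ e → nae? (bits σ e)) gadget

extend : Bool → Triple → Assignment
extend t v = t ∷ t ∷ v

OneEqual : Pred Assignment _
OneEqual (s ∷ t ∷ v) = s ≡ t × ∃ λ i → v ≡ oneEqual s i

oneEqual? : Decidable OneEqual
oneEqual? (s ∷ t ∷ v) = s Bool.≟ t ×-dec Fin.any? (λ i → ≡-dec Bool._≟_ v (oneEqual s i))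

oneEqual⇒proper : ∀ {σ} → OneEqual σ → Proper σ
oneEqual⇒proper {σ} = toWitness {a? = ∀-bits? (λ σ → oneEqual? σ →-dec proper? σ)} _ σ

-- By pigeonhole two of a, b, c share a bit; if the terminals differed, one of them would have that
-- bit too and its edge would be constant. Here this is checked over all assignments.
proper⇒terminals-agree : ∀ {s t v} → Proper (s ∷ t ∷ v) → s ≡ t
proper⇒terminals-agree {s} {t} {v} = toWitness {a? = ∀-bits? agree?} _ (s ∷ t ∷ v)
  where
  agree? : Decidable λ σ → Proper σ → lookup σ x ≡ lookup σ y
  agree? σ = proper? σ →-dec (lookup σ x Bool.≟ lookup σ y)

extendible⇔agree : ∀ s t → (∃ λ σ → Proper σ × bits σ terminals ≡ s ∷ t ∷ []) ⇔ (s ≡ t)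
extendible⇔agree s t = mk⇔
  (λ { (_ ∷ _ ∷ _ , proper , ≡.refl) → proper⇒terminals-agree proper })
  (λ { ≡.refl → extend s (oneEqual s zero) , oneEqual⇒proper (≡.refl , zero , ≡.refl) , ≡.refl })

module Proof {p ℓ₁ ℓ₂ ℓ₃} (K : OrderedField p ℓ₁ ℓ₂ ℓ₃) where

  open OrderedField K hiding (zero)
  open Random K
  open CommutativeRing commutativeRing using (semiring)
  open RingProperties ring using (+-cancelˡ)
  open SemiringMult semiring
    using (×-assoc-*; ×-homo-1; ×-congʳ; ×1-homo-*) renaming (_×_ to _·_)
  open SetoidReasoning setoid

  -- Reciprocals of natural numbers in the field.

  fromℕ-1/ : ∀ n .{{_ : NonZero n}} → fromℕ n * 1/ n ≈ 1#
  -- Apartness from 0 yields an inverse of the difference `fromℕ n - 0#`, which `x-0≈x` simplifies.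
  fromℕ-1/ n = trans (*-congʳ (sym (x-0≈x _))) (proj₂ (proj₂ (#⇒invertible (fromℕ#0 n))))

  1/-unique : ∀ n .{{_ : NonZero n}} {z} → fromℕ n * z ≈ 1# → z ≈ 1/ n
  1/-unique n {z} nz≈1 = begin
    z                   ≈⟨ *-identityˡ z ⟨
    1# * z              ≈⟨ *-congʳ (trans (*-comm _ _) (fromℕ-1/ n)) ⟨
    1/ n * fromℕ n * z  ≈⟨ *-assoc _ _ _ ⟩
    1/ n * (fromℕ n * z) ≈⟨ *-congˡ nz≈1 ⟩
    1/ n * 1#           ≈⟨ *-identityʳ _ ⟩
    1/ n                ∎

  fromℕ-* : ∀ n z → fromℕ n * z ≈ n · z
  fromℕ-* n z = trans (×-assoc-* n 1# z) (×-congʳ n (*-identityˡ z))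

  ·-1/ : ∀ m n .{{_ : NonZero n}} .{{_ : NonZero (n ℕ.* m)}} → m · 1/ (n ℕ.* m) ≈ 1/ n
  ·-1/ m n = 1/-unique n (begin
    fromℕ n * (m · 1/ (n ℕ.* m))         ≈⟨ *-congˡ (fromℕ-* m _) ⟨
    fromℕ n * (fromℕ m * 1/ (n ℕ.* m))   ≈⟨ *-assoc _ _ _ ⟨
    fromℕ n * fromℕ m * 1/ (n ℕ.* m)     ≈⟨ *-congʳ (×1-homo-* n m) ⟨
    fromℕ (n ℕ.* m) * 1/ (n ℕ.* m)       ≈⟨ fromℕ-1/ (n ℕ.* m) ⟩
    1#                                   ∎)

  1/-* : ∀ m n .{{_ : NonZero m}} .{{_ : NonZero n}} .{{_ : NonZero (m ℕ.* n)}} →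
         1/ m * 1/ n ≈ 1/ (m ℕ.* n)
  1/-* m n = 1/-unique (m ℕ.* n) (begin
    fromℕ (m ℕ.* n) * (1/ m * 1/ n)   ≈⟨ *-congʳ (×1-homo-* m n) ⟩
    fromℕ m * fromℕ n * (1/ m * 1/ n) ≈⟨ *-congˡ (*-comm _ _) ⟩
    fromℕ m * fromℕ n * (1/ n * 1/ m) ≈⟨ *-assoc _ _ _ ⟩
    fromℕ m * (fromℕ n * (1/ n * 1/ m)) ≈⟨ *-congˡ (*-assoc _ _ _) ⟨
    fromℕ m * (fromℕ n * 1/ n * 1/ m) ≈⟨ *-congˡ (*-congʳ (fromℕ-1/ n)) ⟩
    fromℕ m * (1# * 1/ m)             ≈⟨ *-congˡ (*-identityˡ _) ⟩
    fromℕ m * 1/ m                    ≈⟨ fromℕ-1/ m ⟩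
    1#                                ∎)

  ·-neg : ∀ n {z} → z < 0# → ℕ.suc n · z < 0#
  ·-neg ℕ.zero    z<0 = <-respˡ-≈ (sym (+-identityʳ _)) z<0
  ·-neg (ℕ.suc n) z<0 = <-trans
    (<-respʳ-≈ (+-identityˡ _) (+-monoˡ-< _ z<0)) (·-neg n z<0)

  -- If `1/ n` were negative, so would be its n-fold multiple, which is 1, against `0<1`.
  1/-nonneg : ∀ n .{{_ : NonZero n}} → ¬ (1/ n < 0#)
  1/-nonneg (ℕ.suc n) 1/n<0 = <-irrefl refl (<-trans 0<1
    (<-respˡ-≈ (trans (sym (fromℕ-* (ℕ.suc n) _)) (fromℕ-1/ (ℕ.suc n))) (·-neg n 1/n<0)))

  -- Finite sums over lists.

  module _ {ℓ} {A : Set ℓ} where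

    ∑ₗ : (A → Carrier) → List A → Carrier
    ∑ₗ f = foldr (λ z s → f z + s) 0#

    ∑ₗ-++ : ∀ f zs {ws} → ∑ₗ f (zs ++ ws) ≈ ∑ₗ f zs + ∑ₗ f ws
    ∑ₗ-++ f List.[]       = sym (+-identityˡ _)
    ∑ₗ-++ f (z List.∷ zs) = trans (+-congˡ (∑ₗ-++ f zs)) (sym (+-assoc _ _ _))

    ∑ₗ-if : ∀ {q} {Q : Pred A q} (Q? : Decidable Q) (f : A → Carrier) zs →
            ∑ₗ (λ z → if does (Q? z) then f z else 0#) zs ≈ ∑ₗ f (filter Q? zs)
    ∑ₗ-if Q? f List.[]       = refl
    ∑ₗ-if Q? f (z List.∷ zs) with does (Q? z)
    ... | true  = +-congˡ (∑ₗ-if Q? f zs)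
    ... | false = trans (+-identityˡ _) (∑ₗ-if Q? f zs)

    ∑ₗ-support : ∀ {q} {Q : Pred A q} (Q? : Decidable Q) {f : A → Carrier} →
                 (∀ z → ¬ Q z → f z ≈ 0#) → ∀ zs → ∑ₗ f zs ≈ ∑ₗ f (filter Q? zs)
    ∑ₗ-support Q? f≈0 List.[]       = refl
    ∑ₗ-support Q? f≈0 (z List.∷ zs) with Q? z
    ... | yes _ = +-congˡ (∑ₗ-support Q? f≈0 zs)
    ... | no ¬q = trans (+-cong (f≈0 z ¬q) (∑ₗ-support Q? f≈0 zs)) (+-identityˡ _)

    ∑ₗ-const : ∀ {f : A → Carrier} {k zs} → All (λ z → f z ≈ k) zs → ∑ₗ f zs ≈ length zs · k
    ∑ₗ-const All.[]         = refl
    ∑ₗ-const (f≈k All.∷ fs) = +-cong f≈k (∑ₗ-const fs)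

  -- With sums indexed by explicit lists, events become filtered lists that evaluate even though the
  -- weights are abstract.
  ∑≈∑ₗ : ∀ n (f : Vec Bool n → Carrier) → ∑ n f ≈ ∑ₗ f (assignments n)
  ∑≈∑ₗ ℕ.zero    f = sym (+-identityʳ _)
  ∑≈∑ₗ (ℕ.suc n) f = trans (+-cong (half false) (half true))
    (sym (∑ₗ-++ f (List.map (false ∷_) (assignments n))))
    where
    half : ∀ t → ∑ n (f ∘ (t ∷_)) ≈ ∑ₗ f (List.map (t ∷_) (assignments n))
    half t = trans (∑≈∑ₗ n (f ∘ (t ∷_)))
      (reflexive (≡.sym (List.foldr-map _ (t ∷_) 0# (assignments n))))

  -- The balanced law and its event probabilities.

  balancedWeight : Assignment → Carrier
  balancedWeight σ = if does (oneEqual? σ) then 1/ 6 else 0#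

  balanced-on : ∀ σ → OneEqual σ → balancedWeight σ ≈ 1/ 6
  balanced-on σ one with oneEqual? σ
  ... | yes _   = refl
  ... | no ¬one = ⊥-elim (¬one one)

  balanced-off : ∀ σ → ¬ OneEqual σ → balancedWeight σ ≈ 0#
  balanced-off σ ¬one with oneEqual? σ
  ... | yes one = ⊥-elim (¬one one)
  ... | no _    = refl

  -- The pivot of the equivalence: uniform edges and the conditional description are each shown
  -- equivalent to this pointwise condition, free of sums and conditioning.
  Balanced : Pred RandomProperColouring _
  Balanced μ = ∀ σ → weight μ σ ≈ balancedWeight σ

  module _ (μ : RandomProperColouring) where

    Pr-filter : ∀ {q} {A : Pred Assignment q} (A? : Decidable A) →
                Pr μ A? ≈ ∑ₗ (weight μ) (filter A? (assignments 5))
    Pr-filter A? = trans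
      (∑≈∑ₗ 5 (λ σ → if does (A? σ) then weight μ σ else 0#)) (∑ₗ-if A? (weight μ) (assignments 5))

    Pr-proper : ∀ {q} {A : Pred Assignment q} (A? : Decidable A) →
                Pr μ A? ≈ ∑ₗ (weight μ) (filter proper? (filter A? (assignments 5)))
    Pr-proper A? = trans (Pr-filter A?)
      (∑ₗ-support proper? (supported μ) (filter A? (assignments 5)))

    -- All weight sits equally on the `OneEqual` assignments, so a probability reduces to a count
    -- that can be evaluated.
    Pr-balanced : Balanced μ → ∀ {q} {A : Pred Assignment q} (A? : Decidable A) →
                  Pr μ A? ≈ length (filter oneEqual? (filter A? (assignments 5))) · 1/ 6
    Pr-balanced bal A? = trans (Pr-filter A?) (trans
      (∑ₗ-support oneEqual? (λ σ ¬one → trans (bal σ) (balanced-off σ ¬one)) (filter A? (assignments 5)))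
      (∑ₗ-const (All.map (λ {σ} one → trans (bal σ) (balanced-on σ one))
        (all-filter oneEqual? (filter A? (assignments 5))))))

    balanced⇒edges : Balanced μ → AllEdgesUniform μ
    balanced⇒edges bal e e∈ v nae = begin
      Pr μ (bits≟ μ e v)  ≈⟨ Pr-balanced bal (bits≟ μ e v) ⟩
      count e v · 1/ 6    ≡⟨ ≡.cong (_· 1/ 6) (count≡1 e∈ v nae) ⟩
      1 · 1/ 6            ≈⟨ ×-homo-1 _ ⟩
      1/ 6                ∎
      where
      count : Vec Vertex 3 → Triple → ℕ
      count e v = length (filter oneEqual? (filter (bits≟ μ e v) (assignments 5)))

      -- Each edge maps the six `OneEqual` assignments bijectively onto `NAE₃`.
      count≡1 : ∀ {e} → e ∈ gadget → ∀ v → NAE₃ v → count e v ≡ 1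
      count≡1 = All.lookup (toWitness
        {a? = All.all? (λ e → ∀-bits? (λ v → nae? v →-dec (count e v ℕ.≟ 1))) gadget} _)

    balanced⇒T-uniform : Balanced μ → TerminalUniform μ
    -- Three of the six `OneEqual` assignments have this terminal bit, and 3 · 1/6 = 1/2.
    balanced⇒T-uniform bal false = trans (Pr-balanced bal (T≟ μ false)) (·-1/ 3 2)
    balanced⇒T-uniform bal true  = trans (Pr-balanced bal (T≟ μ true)) (·-1/ 3 2)

    -- Uniform edges force the balanced law.

    properWith : Vec Vertex 3 → Triple → List Assignment
    properWith e v = filter proper? (filter (bits≟ μ e v) (assignments 5))

    Pr-edge : ∀ e v → Pr μ (bits≟ μ e v) ≈ ∑ₗ (weight μ) (properWith e v)
    Pr-edge e v = Pr-proper (bits≟ μ e v)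

    edges⇒oneEqual-weight : AllEdgesUniform μ → ∀ t i → weight μ (extend t (oneEqual t i)) ≈ 1/ 6
    -- The edge must contain the auxiliary equal to t, since the others are then forced to 1 - t.
    -- Cases are split so that the list of proper colourings above the edge value evaluates to a
    -- singleton.
    edges⇒oneEqual-weight uniform = λ where
        false zero             → weight-at xab∈ false zero ≡.refl
        false (suc zero)       → weight-at xab∈ false (suc zero) ≡.refl
        false (suc (suc zero)) → weight-at xac∈ false (suc (suc zero)) ≡.refl
        true  zero             → weight-at xab∈ true zero ≡.refl
        true  (suc zero)       → weight-at xab∈ true (suc zero) ≡.refl
        true  (suc (suc zero)) → weight-at xac∈ true (suc (suc zero)) ≡.refl
      where
      xab∈ : x ∷ a ∷ b ∷ [] ∈ gadget
      xab∈ = here ≡.refl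

      xac∈ : x ∷ a ∷ c ∷ [] ∈ gadget
      xac∈ = there (here ≡.refl)

      weight-at : ∀ {e} → e ∈ gadget → ∀ t i → let σ = extend t (oneEqual t i) in
        properWith e (bits σ e) ≡ List.[ σ ] → weight μ σ ≈ 1/ 6
      weight-at {e} e∈ t i only = begin
        weight μ σ                               ≈⟨ +-identityʳ _ ⟨
        ∑ₗ (weight μ) List.[ σ ]                 ≡⟨ ≡.cong (∑ₗ (weight μ)) only ⟨
        ∑ₗ (weight μ) (properWith e (bits σ e))  ≈⟨ Pr-edge e (bits σ e) ⟨
        Pr μ (bits≟ μ e (bits σ e))              ≈⟨ uniform e e∈ (bits σ e) nae ⟩
        1/ 6                                     ∎
        where
        σ : Assignment
        σ = extend t (oneEqual t i)

        nae : NAE₃ (bits σ e)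
        nae = All.lookup (oneEqual⇒proper {σ} (≡.refl , i , ≡.refl)) e∈

    -- The colouring with only c = t already carries the full 1/6 of the edge value it shares with
    -- this one, so cancellation leaves 0.
    edges⇒noneEqual-weight : AllEdgesUniform μ → ∀ t → weight μ (extend t (replicate 3 (not t))) ≈ 0#
    edges⇒noneEqual-weight uniform t = +-cancelˡ _ _ _ (begin
      one + none                    ≈⟨ shared t ⟨
      Pr μ (bits≟ μ (x ∷ a ∷ b ∷ []) (t ∷ not t ∷ not t ∷ []))
                                    ≈⟨ uniform _ (here ≡.refl) _ (nonconstant t) ⟩
      1/ 6                          ≈⟨ edges⇒oneEqual-weight uniform t (suc (suc zero)) ⟨
      one                           ≈⟨ +-identityʳ _ ⟨
      one + 0#                      ∎)
      where
      none = weight μ (extend t (replicate 3 (not t)))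
      one  = weight μ (extend t (oneEqual t (suc (suc zero))))

      nonconstant : ∀ t → NAE₃ (t ∷ not t ∷ not t ∷ [])
      nonconstant false = (λ ()) , (λ ())
      nonconstant true  = (λ ()) , (λ ())

      shared : ∀ t → Pr μ (bits≟ μ (x ∷ a ∷ b ∷ []) (t ∷ not t ∷ not t ∷ [])) ≈
        weight μ (extend t (oneEqual t (suc (suc zero)))) + weight μ (extend t (replicate 3 (not t)))
      shared false = trans (Pr-edge (x ∷ a ∷ b ∷ []) (false ∷ true ∷ true ∷ []))
        (+-congˡ (+-identityʳ _))
      -- The enumeration puts c = false first, so for t = true the two summands come in the opposite
      -- order.
      shared true  = trans (Pr-edge (x ∷ a ∷ b ∷ []) (true ∷ false ∷ false ∷ []))
        (trans (+-congˡ (+-identityʳ _)) (+-comm _ _))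

    balanced : (∀ t i → weight μ (extend t (oneEqual t i)) ≈ 1/ 6) →
               (∀ σ → ¬ OneEqual σ → weight μ σ ≈ 0#) → Balanced μ
    balanced on off σ with oneEqual? σ
    balanced on off (s ∷ _ ∷ _) | yes (≡.refl , i , ≡.refl) = on s i
    balanced on off σ           | no ¬one = off σ ¬one

    edges⇒balanced : AllEdgesUniform μ → Balanced μ
    edges⇒balanced uniform = balanced (edges⇒oneEqual-weight uniform) (λ σ → off σ (proper? σ))
      where
      -- At most one auxiliary of a proper colouring equals the terminal bit, so outside `OneEqual`
      -- none does.
      noneEqual : ∀ σ → Proper σ → ¬ OneEqual σ → σ ≡ extend (head σ) (replicate 3 (not (head σ)))
      noneEqual = toWitness {a? = ∀-bits? (λ σ →
        proper? σ →-dec (¬? (oneEqual? σ) →-dec ≡-dec Bool._≟_ σ _))} _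

      off : ∀ σ → Dec (Proper σ) → ¬ OneEqual σ → weight μ σ ≈ 0#
      off σ (no ¬proper) _    = supported μ σ ¬proper
      off σ (yes proper) ¬one = ≡.subst (λ σ → weight μ σ ≈ 0#)
        (≡.sym (noneEqual σ proper ¬one)) (edges⇒noneEqual-weight uniform (head σ))

    -- Conditioning on the terminal bit.

    joint-law : ∀ t v → Pr μ (λ σ → bits≟ μ auxiliaries v σ ×-dec T≟ μ t σ) ≈ weight μ (extend t v)
    joint-law t v = begin
      Pr μ (event? (t ∷ v))          ≈⟨ Pr-filter (event? (t ∷ v)) ⟩
      ∑ₗ (weight μ) (event (t ∷ v))  ≡⟨ ≡.cong (∑ₗ (weight μ)) (singleton (t ∷ v)) ⟩
      weight μ (extend t v) + 0#     ≈⟨ +-identityʳ _ ⟩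
      weight μ (extend t v)          ∎
      where
      -- Packing t and v into one vector `u` lets a single `∀-bits?` check both; the event fixes all
      -- five bits, leaving one assignment.
      event? : ∀ u → Decidable λ σ →
        bits σ auxiliaries ≡ tail u × bits σ terminals ≡ replicate 2 (head u)
      event? u σ = bits≟ μ auxiliaries (tail u) σ ×-dec T≟ μ (head u) σ

      event : Vec Bool 4 → List Assignment
      event u = filter (event? u) (assignments 5)

      singleton : ∀ u → event u ≡ List.[ head u ∷ u ]
      singleton = toWitness {a? = ∀-bits? (λ u → List.≡-dec (≡-dec Bool._≟_) (event u) _)} _

    module _ (T-uniform : TerminalUniform μ) where

      -- Clearing the denominator `Pr (T≟ t)`, which is 1/2, turns claims about the kernel into
      -- claims about weights.
      conditional⇔weight : ∀ t v {z} →
        (conditional μ T-uniform t v ≈ z) ⇔ (weight μ (extend t v) ≈ z * 1/ 2)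
      conditional⇔weight t v {z} = mk⇔
        (λ cond≈z → begin
          w            ≈⟨ cancel w (trans (*-comm _ _) q⁻¹*q≈1) ⟨
          w * q⁻¹ * q  ≈⟨ *-congʳ (trans (*-congʳ (sym (joint-law t v))) cond≈z) ⟩
          z * q        ≈⟨ *-congˡ (T-uniform t) ⟩
          z * 1/ 2     ∎)
        (λ w≈ → begin
          conditional μ T-uniform t v  ≈⟨ *-congʳ (trans (joint-law t v) w≈) ⟩
          z * 1/ 2 * q⁻¹               ≈⟨ *-congʳ (*-congˡ (T-uniform t)) ⟨
          z * q * q⁻¹                  ≈⟨ cancel z q⁻¹*q≈1 ⟩
          z                            ∎)
        where
        w   = weight μ (extend t v)
        q   = Pr μ (T≟ μ t)
        q#0 = #-congʳ (sym (T-uniform t)) (1/#0 2)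
        q⁻¹ = inv q q#0

        q⁻¹*q≈1 : q * q⁻¹ ≈ 1#
        q⁻¹*q≈1 = trans (*-congʳ (sym (x-0≈x q))) (proj₂ (proj₂ (#⇒invertible q#0)))

        cancel : ∀ z {u v} → u * v ≈ 1# → z * u * v ≈ z
        cancel z uv≈1 = trans (*-assoc _ _ _) (trans (*-congˡ uv≈1) (*-identityʳ z))

      balanced⇒exactlyOne : Balanced μ → ∀ t → ExactlyOneEqualUniformly μ T-uniform t
      balanced⇒exactlyOne bal t =
          (λ i → from (conditional⇔weight t (oneEqual t i))
            (trans (on (extend t (oneEqual t i)) (≡.refl , i , ≡.refl)) (sym (1/-* 3 2))))
        , (λ v v≢ → from (conditional⇔weight t v)
            (trans (off (extend t v) (λ { (_ , i , v≡) → v≢ i v≡ })) (sym (zeroˡ _))))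
        where
        open Equivalence

        on : ∀ σ → OneEqual σ → weight μ σ ≈ 1/ 6
        on σ one = trans (bal σ) (balanced-on σ one)

        off : ∀ σ → ¬ OneEqual σ → weight μ σ ≈ 0#
        off σ ¬one = trans (bal σ) (balanced-off σ ¬one)

      -- The kernel determines the weights where the terminals agree; where they differ, properness
      -- fails and the support condition gives 0.
      exactlyOne⇒balanced : (∀ t → ExactlyOneEqualUniformly μ T-uniform t) → Balanced μ
      exactlyOne⇒balanced exact = balanced
        (λ t i → trans (to (conditional⇔weight t (oneEqual t i)) (proj₁ (exact t) i)) (1/-* 3 2))
        (λ { (s ∷ t ∷ v) → off s t v (s Bool.≟ t) })
        where
        open Equivalence

        off : ∀ s t v → Dec (s ≡ t) → ¬ OneEqual (s ∷ t ∷ v) → weight μ (s ∷ t ∷ v) ≈ 0#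
        off s t v (no s≢t)     _    = supported μ (s ∷ t ∷ v) (s≢t ∘ proper⇒terminals-agree)
        off s _ v (yes ≡.refl) ¬one = trans
          (to (conditional⇔weight s v) (proj₂ (exact s) v (λ i v≡ → ¬one (≡.refl , i , v≡))))
          (zeroˡ _)

      edges⇔exactlyOne : AllEdgesUniform μ ⇔ (∀ t → ExactlyOneEqualUniformly μ T-uniform t)
      edges⇔exactlyOne = mk⇔
        (balanced⇒exactlyOne ∘ edges⇒balanced) (balanced⇒edges ∘ exactlyOne⇒balanced)

  -- Existence and uniqueness of the kernel.

  balancedColouring : RandomProperColouring
  balancedColouring = record
    { weight    = balancedWeight
    ; nonneg    = nonneg′
    -- The filtered list evaluates to length 6, so the total is 6 · 1/6.
    ; total     = trans (∑≈∑ₗ 5 balancedWeight) (trans (∑ₗ-if oneEqual? (λ _ → 1/ 6) (assignments 5))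
        (trans (∑ₗ-const (All.universal (λ _ → refl) (filter oneEqual? (assignments 5))))
          (trans (sym (fromℕ-* 6 _)) (fromℕ-1/ 6))))
    ; supported = λ σ ¬proper → balanced-off σ (¬proper ∘ oneEqual⇒proper)
    }
    where
    nonneg′ : ∀ σ → ¬ (balancedWeight σ < 0#)
    nonneg′ σ with does (oneEqual? σ)
    ... | true  = 1/-nonneg 6
    ... | false = <-irrefl refl

  balancedColouring-T-uniform : TerminalUniform balancedColouring
  balancedColouring-T-uniform = balanced⇒T-uniform balancedColouring (λ _ → refl)

  balancedKernel : Kernel
  balancedKernel = conditional balancedColouring balancedColouring-T-uniform

  -- Preservation concerns every colouring with this conditional law, so the exactly-one description
  -- is carried along `κ≋` and gives uniform edges for each.
  balancedKernel-preserving : ProbabilityPreserving balancedKernel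
  balancedKernel-preserving =
      (balancedColouring , balancedColouring-T-uniform , λ _ _ → refl)
    , λ μ u κ≋ → balanced⇒edges μ (exactlyOne⇒balanced μ u (λ t →
        (λ i → trans (sym (κ≋ t (oneEqual t i))) (proj₁ (exact t) i))
      , (λ v v≢ → trans (sym (κ≋ t v)) (proj₂ (exact t) v v≢))))
    where
    exact : ∀ t → ExactlyOneEqualUniformly balancedColouring balancedColouring-T-uniform t
    exact = balanced⇒exactlyOne balancedColouring balancedColouring-T-uniform (λ _ → refl)

  -- A preserving kernel is the conditional of some `μ`, and preservation applied to that `μ` makes
  -- it balanced. Equal weights then give equal conditionals.
  balancedKernel-unique : ∀ {κ} → ProbabilityPreserving κ → balancedKernel ≋ κ
  balancedKernel-unique ((μ , u , κ≋) , preserving) t v = trans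
    (Equivalence.from (conditional⇔weight balancedColouring balancedColouring-T-uniform t v)
      (trans (sym (edges⇒balanced μ (preserving μ u κ≋) (extend t v)))
        -- Here z is the conditional probability under `μ` itself, so `refl` expresses the weight
        -- through it.
        (Equivalence.to (conditional⇔weight μ u t v) refl)))
    (sym (κ≋ t v))

lemma5p8 : ∀ {p ℓ₁ ℓ₂ ℓ₃} (K : OrderedField p ℓ₁ ℓ₂ ℓ₃) → let open Random K in
    (∀ s t → (∃ λ σ → Proper σ × bits σ terminals ≡ s ∷ t ∷ []) ⇔ (s ≡ t))
    × (∀ (μ : RandomProperColouring) (T-uniform : TerminalUniform μ) → AllEdgesUniform μ ⇔ (∀ t → ExactlyOneEqualUniformly μ T-uniform t))
    × ∃! _≋_ ProbabilityPreserving
lemma5p8 K = extendible⇔agree , edges⇔exactlyOne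
  , balancedKernel , balancedKernel-preserving , balancedKernel-unique
  where open Proof K
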